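{- Let $n,d$ be integers with $d>3$ and $n-d>1$, and let $G=L_{n,d}$ be the lollipop network of order $n$, with nodes $v_1,\ldots,v_d,u_1,\ldots,u_{n-d}$. Then, for $v\in V(G)$, $$IMC(v)=\begin{cases} \dfrac{3(n-d)\big((n-1)(2d-1)-d^2\big)+d(d-1)(3n-d-4)}{(n-2)\big(3(n-d)(d^2-1+n)+d(d^2-1)\big)}, & \text{if } v=v_1;\\[3mm] \dfrac{6(n-d)\big(2(d-1)(n-1)-d^2\big)+2(d-1)\big(3(d-1)(n-1)-d(d+1)\big)}{(n-3)\big(3(n-d)(d^2-1+n)+d(d^2-1)\big)}, & \text{if } v=v_i\ (2\le i\le d-1);\\[3mm] \dfrac{3(n-d)(d^2-1+n)+d(d-1)(d-n+2)}{3(n-d)(d^2-1+n)+d(d^2-1)}, & \text{if } v=v_d;\\[3mm] \dfrac{(n-d)\big(d(2d-1)+3(n-1)\big)}{3(n-d)(d^2-1+n)+d(d^2-1)}, & \text{if } v=u_j\ (1\le j\le n-d). \end{cases}$$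
   Context: All graphs are finite, simple and undirected. The order of a graph is its number of nodes; $d_{uv}$ denotes the length of a shortest path between nodes $u$ and $v$. For a connected graph $H$ of order $m\ge 2$, the agglomeration is $$\phi(H)=\frac{m-1}{\sum_{u,v\in V(H),\,u\ne v} d_{uv}},$$ where the sum is over all ordered pairs $(u,v)$ of distinct nodes (equivalently $\phi(H)=1/(mL(H))$, where $L(H)=\frac{1}{m(m-1)}\sum_{u\neq v}d_{uv}$ is the average path length); if $m=1$, then $\phi(H)=1$. For a node $v$ of a graph $G$, the node contraction $G'(v)$ is the simple graph obtained from $G$ by replacing $v$ together with all its $\deg(v)$ neighbors (these $\deg(v)+1$ nodes) by one new node $v'$, which is adjacent to every remaining node that was adjacent in $G$ to at least one of the replaced nodes; adjacency among the remaining nodes is unchanged. The importance of $v$ in $G$ is $$IMC(v)=1-\frac{\phi(G)}{\phi(G'(v))}.$$ The lollipop network $L_{n,d}$ is the graph of order $n$ obtained from a complete graph $K_{n-d}$ with nodes $u_1,\ldots,u_{n-d}$ and a path $P_d$ $(d>1)$ with nodes $v_1,\ldots,v_d$ (in this order along the path) by joining the end-node $v_d$ of $P_d$ to all the nodes of $K_{n-d}$; thus $\deg(v_1)=1$ and $\deg(v_d)=n-d+1$. -}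

module Defs where

open import Agda.Builtin.FromNat public using (Number; fromNat)
open import Agda.Builtin.Unit public using (tt)
open import Data.Bool.Base using (if_then_else_)
open import Data.Empty using (⊥)
open import Data.Fin.Base using (Fin; zero; suc; toℕ; fromℕ; inject₁)
open import Data.Fin.Induction using (<-weakInduction)
import Data.Fin.Properties as Fin
open import Data.Integer.Base using (+_)
open import Data.List.Base
  using (List; _++_; map; filter; length; allFin; cartesianProduct; deduplicate)
open import Data.List.Membership.Propositional using (_∈_; lose)
open import Data.List.Membership.Propositional.Properties
  using (∈-map⁺; ∈-map⁻; ∈-++⁺ˡ; ∈-++⁺ʳ; ∈-allFin; ∈-deduplicate⁺)
open import Data.List.Relation.Unary.Any using (any?; satisfied)
open import Data.List.Relation.Unary.Unique.Propositional using (Unique)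
import Data.List.Relation.Unary.Unique.Propositional.Properties as Unique
import Data.List.Relation.Unary.Unique.DecPropositional.Properties as DecUnique
open import Data.Maybe.Base using (Maybe; just; nothing)
import Data.Maybe.Properties as Maybe
open import Data.Nat.Base using (ℕ; zero; suc; _≤_; _<_; _∸_; z≤n; s≤s)
open import Data.Nat.ListAction using (sum)
import Data.Nat.Literals as ℕ
import Data.Nat.Properties as ℕ
open import Data.Product.Base using (Σ; Σ-syntax; ∃; ∃-syntax; _×_; _,_; proj₁; proj₂)
open import Data.Rational.Base using (ℚ; 0ℚ; _-_; _÷_; ≢-nonZero)
open import Data.Rational.Literals using (fromℤ)
import Data.Rational.Literals as ℚ
import Data.Rational.Properties as ℚ
open import Data.Sum.Base using (_⊎_; inj₁; inj₂; swap)
import Data.Sum.Properties as Sum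
open import Function.Base using (_∘_)
open import Relation.Binary.Definitions using (DecidableEquality)
open import Relation.Binary.PropositionalEquality
  using (_≡_; _≢_; refl; sym; cong; subst₂; ≢-sym)
open import Relation.Nullary.Decidable
  using (Dec; yes; no; does; ¬?; map′; _×-dec_; _⊎-dec_; False; fromWitnessFalse; toWitnessFalse)
open import Relation.Nullary.Negation using (¬_; contradiction)
open import Relation.Unary using (Pred; Decidable)
open import Data.Bool.Properties using (T-irrelevant)

instance
  ℕ-literals : Number ℕ
  ℕ-literals = ℕ.number

  ℚ-literals : Number ℚ
  ℚ-literals = ℚ.number

fromℕℚ : ℕ → ℚ
fromℕℚ n = fromℤ (+ n)

infixl 7 _÷₀_

-- Division made total by p ÷₀ 0 = 0; on connected nonempty graphs the divisors
-- in φ and IMC are nonzero.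
_÷₀_ : ℚ → ℚ → ℚ
p ÷₀ q with q ℚ.≟ 0ℚ
... | yes _   = 0ℚ
... | no  q≢0 = _÷_ p q {{≢-nonZero q≢0}}

record Graph : Set₁ where
  field
    V        : Set
    _≟_      : DecidableEquality V
    nodes    : List V
    complete : ∀ v → v ∈ nodes
    unique   : Unique nodes

    Adj      : V → V → Set
    adj?     : ∀ u v → Dec (Adj u v)
    symm     : ∀ {u v} → Adj u v → Adj v u
    irrefl   : ∀ {v} → ¬ Adj v v

  order : ℕ
  order = length nodes

  ∃? : ∀ {P : Pred V _} → Decidable P → Dec (∃ P)
  ∃? P? = map′ satisfied (λ (x , px) → lose (complete x) px) (any? P? nodes)

  infixr 5 _∷_

  data Walk : ℕ → V → V → Set where
    []  : ∀ {u} → Walk zero u u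
    _∷_ : ∀ {k u v w} → Adj u v → Walk k v w → Walk (suc k) u w

  walk? : ∀ k u v → Dec (Walk k u v)
  walk? zero    u v = map′ (λ { refl → [] }) (λ { [] → refl }) (u ≟ v)
  walk? (suc k) u w =
    map′ (λ (_ , a , p) → a ∷ p) (λ { (a ∷ p) → _ , a , p })
         (∃? λ v → adj? u v ×-dec walk? k v w)

  Reachable : V → V → Set
  Reachable u v = ∃[ k ] Walk k u v

  Connected : Set
  Connected = ∀ u v → Reachable u v

  trans-reach : ∀ {u v w} → Reachable u v → Reachable v w → Reachable u w
  trans-reach (_ , [])    q = q
  trans-reach (_ , a ∷ p) q = let _ , r = trans-reach (_ , p) q in _ , a ∷ r

  edge : ∀ {u v} → Adj u v → Reachable u v
  edge a = _ , a ∷ []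

  sym-reach : ∀ {u v} → Reachable u v → Reachable v u
  sym-reach (_ , [])    = _ , []
  sym-reach (_ , a ∷ p) = trans-reach (sym-reach (_ , p)) (edge (symm a))

least : ∀ {P : ℕ → Set} → Decidable P → ∀ n → P n → ∃[ k ] P k × (∀ {j} → P j → k ≤ j)
least P? zero p = 0 , p , λ _ → z≤n
least P? (suc n) p with P? 0
... | yes p₀ = 0 , p₀ , λ _ → z≤n
... | no ¬p₀ with least (P? ∘ suc) n p
...   | k , pk , min = suc k , pk , λ
  { {zero}  p₀ → contradiction p₀ ¬p₀
  ; {suc j} pj → s≤s (min pj)
  }

module _ (G : Graph) (conn : Graph.Connected G) where
  open Graph G

  shortest : ∀ u v → ∃[ k ] Walk k u v × (∀ {j} → Walk j u v → k ≤ j)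
  shortest u v = let k , p = conn u v in least (λ k → walk? k u v) k p

  dist : V → V → ℕ
  dist u v = proj₁ (shortest u v)

  totalDistance : ℕ
  totalDistance =
    sum (map (λ (u , v) → dist u v)
             (filter (λ (u , v) → ¬? (u ≟ v)) (cartesianProduct nodes nodes)))

  φ : ℚ
  φ = if does (order ℕ.≟ 1)
      then 1
      else (fromℕℚ order - 1) ÷₀ fromℕℚ totalDistance

module Contraction (G : Graph) (v : Graph.V G) where
  open Graph G

  Closed : V → Set
  Closed w = w ≡ v ⊎ Adj v w

  closed? : Decidable Closed
  closed? w = (w ≟ v) ⊎-dec adj? v w

  Remaining : Set
  Remaining = Σ[ w ∈ V ] False (closed? w)

  -- `nothing` is the new node v′.
  V′ : Set
  V′ = Maybe Remaining

  Adj′ : V′ → V′ → Set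
  Adj′ nothing        nothing        = ⊥
  Adj′ nothing        (just (w , _)) = ∃[ x ] Closed x × Adj x w
  Adj′ (just (w , _)) nothing        = ∃[ x ] Closed x × Adj x w
  Adj′ (just (w , _)) (just (x , _)) = Adj w x

  remaining-≡ : ∀ {w x} {p : False (closed? w)} {q : False (closed? x)} →
                w ≡ x → _≡_ {A = Remaining} (w , p) (x , q)
  remaining-≡ refl = cong (_ ,_) (T-irrelevant _ _)

  _≟′_ : DecidableEquality V′
  _≟′_ = Maybe.≡-dec λ (w , _) (x , _) → map′ remaining-≡ (cong proj₁) (w ≟ x)

  adj′? : ∀ a b → Dec (Adj′ a b)
  adj′? nothing        nothing        = no λ ()
  adj′? nothing        (just (w , _)) = ∃? λ x → closed? x ×-dec adj? x w
  adj′? (just (w , _)) nothing        = ∃? λ x → closed? x ×-dec adj? x w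
  adj′? (just (w , _)) (just (x , _)) = adj? w x

  symm′ : ∀ {a b} → Adj′ a b → Adj′ b a
  symm′ {nothing} {just _}  a = a
  symm′ {just _}  {nothing} a = a
  symm′ {just _}  {just _}  a = symm a

  irrefl′ : ∀ {a} → ¬ Adj′ a a
  irrefl′ {just _} a = irrefl a

  class : ∀ w → Dec (Closed w) → V′
  class w (yes _) = nothing
  class w (no ¬c) = just (w , fromWitnessFalse ¬c)

  class-closed : ∀ {w} (c? : Dec (Closed w)) → Closed w → class w c? ≡ nothing
  class-closed (yes _) _ = refl
  class-closed (no ¬c) c = contradiction c ¬c

  class-remaining : ∀ {w} (c? : Dec (Closed w)) (p : False (closed? w)) → class w c? ≡ just (w , p)
  class-remaining (yes c) p = contradiction c (toWitnessFalse p)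
  class-remaining (no _)  p = cong just (remaining-≡ refl)

  project : V → V′
  project w = class w (closed? w)

  project-surjective : ∀ a → ∃[ w ] project w ≡ a
  project-surjective nothing  = v , class-closed (closed? v) (inj₁ refl)
  project-surjective (just (w , p)) = w , class-remaining (closed? w) p

  nodes′ : List V′
  nodes′ = deduplicate _≟′_ (map project nodes)

  complete′ : ∀ a → a ∈ nodes′
  complete′ a with project-surjective a
  ... | w , refl = ∈-deduplicate⁺ _≟′_ (∈-map⁺ project (complete w))

  contract : Graph
  contract = record
    { V        = V′
    ; _≟_      = _≟′_
    ; nodes    = nodes′
    ; complete = complete′
    ; unique   = DecUnique.deduplicate-! _≟′_ (map project nodes)
    ; Adj      = Adj′
    ; adj?     = adj′?
    ; symm     = λ {a} {b} → symm′ {a} {b}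
    ; irrefl   = λ {a} → irrefl′ {a}
    }

  private module C = Graph contract

  project-edge : ∀ {w x} → Adj w x → C.Reachable (project w) (project x)
  project-edge {w} {x} a with closed? w | closed? x
  ... | yes _ | yes _ = _ , C.[]
  ... | yes c | no _  = C.edge {nothing} {just _} (w , c , a)
  ... | no _  | yes c = C.edge {just _} {nothing} (x , c , symm a)
  ... | no _  | no _  = C.edge {just _} {just _} a

  project-walk : ∀ {k w x} → Walk k w x → C.Reachable (project w) (project x)
  project-walk []      = _ , C.[]
  project-walk (a ∷ p) = C.trans-reach (project-edge a) (project-walk p)

  contract-connected : Connected → C.Connected
  contract-connected conn a b =
    let w , w≡a = project-surjective a
        x , x≡b = project-surjective b
    in subst₂ C.Reachable w≡a x≡b (project-walk (proj₂ (conn w x)))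

open Contraction public using (contract; contract-connected)

IMC : (G : Graph) → Graph.Connected G → Graph.V G → ℚ
IMC G conn v = 1 - φ G conn ÷₀ φ (contract G v) (contract-connected G v conn)

-- `path i` is v_{i+1} and `clique j` is u_{j+1}, since Fin counts from 0.
pattern path i   = inj₁ i
pattern clique j = inj₂ j

index : ∀ {m} → Fin m → ℕ
index i = suc (toℕ i)

module Lollipop (n d : ℕ) where

  V : Set
  V = Fin d ⊎ Fin (n ∸ d)

  Adj : V → V → Set
  Adj (path i)   (path j)   = index j ≡ suc (index i) ⊎ index i ≡ suc (index j)
  Adj (path i)   (clique _) = index i ≡ d
  Adj (clique _) (path i)   = index i ≡ d
  Adj (clique i) (clique j) = i ≢ j

  adj? : ∀ a b → Dec (Adj a b)
  adj? (path i)   (path j)   = (index j ℕ.≟ suc (index i)) ⊎-dec (index i ℕ.≟ suc (index j))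
  adj? (path i)   (clique _) = index i ℕ.≟ d
  adj? (clique _) (path i)   = index i ℕ.≟ d
  adj? (clique i) (clique j) = ¬? (i Fin.≟ j)

  symm : ∀ {a b} → Adj a b → Adj b a
  symm {path _}   {path _}   = swap
  symm {path _}   {clique _} a = a
  symm {clique _} {path _}   a = a
  symm {clique _} {clique _} = ≢-sym

  irrefl : ∀ {a} → ¬ Adj a a
  irrefl {path _}   (inj₁ e) = ℕ.1+n≢n (sym e)
  irrefl {path _}   (inj₂ e) = ℕ.1+n≢n (sym e)
  irrefl {clique _} i≢i      = i≢i refl

  nodes : List V
  nodes = map inj₁ (allFin d) ++ map inj₂ (allFin (n ∸ d))

  complete : ∀ a → a ∈ nodes
  complete (path i)   = ∈-++⁺ˡ (∈-map⁺ inj₁ (∈-allFin i))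
  complete (clique j) = ∈-++⁺ʳ (map inj₁ (allFin d)) (∈-map⁺ inj₂ (∈-allFin j))

  unique : Unique nodes
  unique = Unique.++⁺
    (Unique.map⁺ Sum.inj₁-injective (Unique.allFin⁺ d))
    (Unique.map⁺ Sum.inj₂-injective (Unique.allFin⁺ (n ∸ d)))
    λ (p , q) → case (∈-map⁻ inj₁ p) (∈-map⁻ inj₂ q)
    where
    case : ∀ {a} → (∃[ i ] i ∈ allFin d × a ≡ inj₁ i) →
           (∃[ j ] j ∈ allFin (n ∸ d) × a ≡ inj₂ j) → ⊥
    case (_ , _ , refl) (_ , _ , ())

  graph : Graph
  graph = record
    { V        = V
    ; _≟_      = Sum.≡-dec Fin._≟_ Fin._≟_
    ; nodes    = nodes
    ; complete = complete
    ; unique   = unique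
    ; Adj      = Adj
    ; adj?     = adj?
    ; symm     = λ {a} {b} → symm {a} {b}
    ; irrefl   = λ {a} → irrefl {a}
    }

lollipop : ℕ → ℕ → Graph
lollipop = Lollipop.graph

lollipop-connected : ∀ n d → Graph.Connected (lollipop n d)
lollipop-connected n zero (clique i) (clique j) with i Fin.≟ j
... | yes refl = _ , Graph.[]
... | no i≢j   = Graph.edge (lollipop n 0) {clique i} {clique j} i≢j
lollipop-connected n (suc d) a b = trans-reach (sym-reach (from-v₁ a)) (from-v₁ b)
  where
  open Graph (lollipop n (suc d))

  along : ∀ i → Reachable (path zero) (path i)
  along = <-weakInduction (λ i → Reachable (path zero) (path i)) (_ , [])
    λ i r → trans-reach r
      (edge {path (inject₁ i)} {path (suc i)}
            (inj₁ (cong (λ k → suc (suc k)) (sym (Fin.toℕ-inject₁ i)))))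

  from-v₁ : ∀ a → Reachable (path zero) a
  from-v₁ (path i)   = along i
  from-v₁ (clique j) = trans-reach (along (fromℕ d))
    (edge {path (fromℕ d)} {clique j} (cong suc (Fin.toℕ-fromℕ d)))

{-# OPTIONS --safe #-}
module Submission where

-- Give v_i level i − 1 and every u_j level d.  Two distinct vertices are then
-- adjacent exactly when their levels differ by at most 1, and they are at
-- distance 1 ⊔ |a − b| when their levels are a and b, so the total distance
-- depends on the multiset of levels only.  Contracting a vertex of level t
-- merges the levels t − 1, t and t + 1; the result again has such levels,
-- namely those of a lollipop with a shorter path (v_1 to v_{d−1}) or those of
-- a path (v_d and u_j).  A lollipop with d path and c clique vertices has total
-- distance T with 3 T = 3 c (d² − 1 + d + c) + d (d² − 1), and the four formulas
-- are algebra.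

open import Defs
open import Data.Bool.Base using (true; false; if_then_else_)
open import Data.Fin.Base using (Fin; zero; suc; toℕ)
import Data.Fin.Properties as Fin
import Data.Integer.Properties as ℤ
import Data.Integer.Tactic.RingSolver as ℤ
open import Data.List.Base as List
  using (List; []; _∷_; _++_; map; filter; replicate; length; tabulate; allFin; cartesianProduct)
open import Data.List.Membership.Propositional using (_∈_)
open import Data.List.Membership.Propositional.Properties using (∈-map⁺; ∈-map⁻; ∈-filter⁺)
open import Data.List.Membership.Propositional.Properties.WithK using (unique∧set⇒bag)
open import Data.List.Properties
  using ( map-∘; map-cong; map-cong-local; map-++; map-tabulate; map-replicate; length-map; length-replicate
        ; filter-all; filter-none; filter-accept; filter-reject; filter-++; filter-≐)
open import Data.List.Relation.Binary.BagAndSetEquality using (∼bag⇒↭)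
open import Data.List.Relation.Binary.Permutation.Propositional
  using (_↭_; prep; swap; ↭-refl; ↭-reflexive; ↭-sym; ↭-trans; module PermutationReasoning)
open import Data.List.Relation.Binary.Permutation.Propositional.Properties
  using (map⁺; filter-↭; ↭-length; ∈-resp-↭)
open import Data.List.Relation.Unary.All as All using (All; []; _∷_)
import Data.List.Relation.Unary.All.Properties as All
open import Data.List.Relation.Unary.AllPairs using ([]; _∷_)
open import Data.List.Relation.Unary.Any using (here; there)
open import Data.List.Relation.Unary.Unique.Propositional using (Unique)
import Data.List.Relation.Unary.Unique.Propositional.Properties as Unique
open import Data.Maybe.Base using (just; nothing)
open import Data.Nat.Base as ℕ using (ℕ; zero; suc; _≤_; _<_; _∸_; z≤n; s≤s; s≤s⁻¹; pred; ∣_-_∣; _⊔_)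
open import Data.Nat.ListAction using (sum)
open import Data.Nat.ListAction.Properties using (sum-++; sum-↭)
import Data.Nat.Properties as ℕ
import Data.Nat.Tactic.RingSolver as ℕ
open import Data.Product.Base using (∃-syntax; _×_; _,_)
import Data.Rational.Properties as ℚ
import Data.Rational.Unnormalised.Base as ℚᵘ
import Data.Rational.Unnormalised.Properties as ℚᵘ
open import Data.Sum.Base as Sum using (_⊎_; inj₁; inj₂)
open import Function.Base using (_∘_; id)
open import Function.Bundles using (_⇔_; mk⇔; module Equivalence)
open import Level using (0ℓ)
open import Relation.Binary.Consequences using (dec⇒weaklyDec)
open import Relation.Binary.PropositionalEquality
  using (_≡_; _≢_; refl; sym; trans; cong; cong₂; subst; ≢-sym; module ≡-Reasoning)
open import Relation.Nullary.Decidable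
  using (Dec; yes; no; does; ¬?; dec-false; fromWitnessFalse; toWitnessFalse)
open import Relation.Nullary.Negation using (¬_; contradiction)
open import Relation.Unary using (Decidable)
open import Tactic.RingSolver using (solve; solve-∀)
open import Tactic.RingSolver.Core.AlmostCommutativeRing
  using (AlmostCommutativeRing; fromCommutativeRing)

open Equivalence using (to; from)

module _ where
  open import Data.Nat.Base using (_+_; _*_)
  open import Data.Nat.Properties
    using ( _≤?_; ≤-refl; ≤-reflexive; ≤-trans; ≤-antisym; n≤1+n; 1+n≢n; suc-injective; <⇒≢; <-asym; +-mono-≤
          ; ⊔-lub; ⊔-sel; *-distribˡ-+; ∣-∣-comm; ∣-∣-identityʳ; ∣-∣-triangle; ∣n-n∣≡0)

  -- Levels on a line and their renumbering.

  Near Far : ℕ → ℕ → Set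
  Near a b = ∣ a - b ∣ ≤ 1
  Far a b = ¬ Near a b

  near? : ∀ a b → Dec (Near a b)
  near? a b = ∣ a - b ∣ ≤? 1

  far? : ∀ a → Decidable (Far a)
  far? a = ¬? ∘ near? a

  near-sym : ∀ {a b} → Near a b → Near b a
  near-sym {a} {b} = subst (_≤ 1) (∣-∣-comm a b)

  suc-gap : ∀ a → ∣ suc a - a ∣ ≡ 1
  suc-gap zero    = refl
  suc-gap (suc a) = suc-gap a

  suc-near : ∀ {a b} → b ≡ suc a → Near a b
  suc-near {a} refl = ≤-reflexive (trans (∣-∣-comm a (suc a)) (suc-gap a))

  near-suc : ∀ {a b} → a ≢ b → Near a b → b ≡ suc a ⊎ a ≡ suc b
  near-suc {zero}        {zero}        a≢b near   = contradiction refl a≢b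
  near-suc {zero}        {1}           a≢b near   = inj₁ refl
  near-suc {1}           {zero}        a≢b near   = inj₂ refl
  near-suc {zero}        {suc (suc b)} a≢b (s≤s ())
  near-suc {suc (suc a)} {zero}        a≢b (s≤s ())
  near-suc {suc a}       {suc b}       a≢b near   = Sum.map (cong suc) (cong suc) (near-suc (a≢b ∘ cong suc) near)

  -- The first step from `a` towards `b`. The bound by `a ⊔ b` matters because occupied levels are
  -- closed downwards, so `c` is the level of some vertex.
  between : ∀ a b {k} → ∣ a - b ∣ ≡ suc k → ∃[ c ] Near a c × ∣ c - b ∣ ≡ k × c ≤ a ⊔ b
  between zero    (suc k) refl = 1 , s≤s z≤n , refl , s≤s z≤n
  between (suc k) zero    refl = k , ≤-reflexive (suc-gap k) , ∣-∣-identityʳ k , n≤1+n k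
  between (suc a) (suc b) e with between a b e
  ... | c , near , rest , c≤ = suc c , near , rest , s≤s c≤

  -- The levels that survive the contraction of a vertex of level t, renumbered
  -- so as to be consecutive around the level pred t of the new vertex.
  shrink : ℕ → ℕ → ℕ
  shrink 0             s       = s ∸ 1
  shrink 1             s       = s ∸ 2
  shrink (suc (suc t)) 0       = 0
  shrink (suc (suc t)) (suc s) = suc (shrink (suc t) s)

  -- A surviving level above `t` drops by one more than the new vertex does; one below `t` stays
  -- while the new vertex descends by one. Either way the gap loses 1.
  far-shrink : ∀ t {s} → Far t s → ∣ t - s ∣ ≡ suc ∣ pred t - shrink t s ∣
  far-shrink 0 {0} far = contradiction z≤n far
  far-shrink 0 {1} far = contradiction ≤-refl far
  far-shrink 0 {suc (suc s)} far = refl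
  far-shrink 1 {0} far = contradiction ≤-refl far
  far-shrink 1 {1} far = contradiction z≤n far
  far-shrink 1 {2} far = contradiction ≤-refl far
  far-shrink 1 {suc (suc (suc s))} far = refl
  far-shrink (suc (suc t)) {0} far = refl
  far-shrink (suc (suc t)) {suc s} far = far-shrink (suc t) far

  -- Settles `shrink-near` when one level is 0, as `Near 0 (suc s)` amounts to `s ≤ 0`. Far levels
  -- above the centre stay positive, those below it do not move.
  shrink-bottom : ∀ t {s} → Far (suc t) s → s ≤ 0 ⇔ shrink (suc t) s ≤ 0
  shrink-bottom 0 {0} far = contradiction ≤-refl far
  shrink-bottom 0 {1} far = contradiction z≤n far
  shrink-bottom 0 {2} far = contradiction ≤-refl far
  shrink-bottom 0 {suc (suc (suc s))} far = mk⇔ (λ ()) (λ ())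
  shrink-bottom (suc t) {0} far = mk⇔ id id
  shrink-bottom (suc t) {suc s} far = mk⇔ (λ ()) (λ ())

  -- Survivors on the same side of `t` shift equally. On opposite sides they are at least 4 apart
  -- before and at least 2 apart after, hence never near.
  shrink-near : ∀ t {a b} → Far t a → Far t b → Near a b ⇔ Near (shrink t a) (shrink t b)
  shrink-near 0 {0} fa fb = contradiction z≤n fa
  shrink-near 0 {1} fa fb = contradiction ≤-refl fa
  shrink-near 0 {suc (suc _)} {0} fa fb = contradiction z≤n fb
  shrink-near 0 {suc (suc _)} {1} fa fb = contradiction ≤-refl fb
  shrink-near 0 {suc (suc _)} {suc (suc _)} fa fb = mk⇔ id id
  shrink-near 1 {0} fa fb = contradiction ≤-refl fa
  shrink-near 1 {1} fa fb = contradiction z≤n fa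
  shrink-near 1 {2} fa fb = contradiction ≤-refl fa
  shrink-near 1 {suc (suc (suc _))} {0} fa fb = contradiction ≤-refl fb
  shrink-near 1 {suc (suc (suc _))} {1} fa fb = contradiction z≤n fb
  shrink-near 1 {suc (suc (suc _))} {2} fa fb = contradiction ≤-refl fb
  shrink-near 1 {suc (suc (suc _))} {suc (suc (suc _))} fa fb = mk⇔ id id
  shrink-near (suc (suc t)) {0} {0} fa fb = mk⇔ id id
  shrink-near (suc (suc t)) {0} {suc b} fa fb =
    let e = shrink-bottom t fb in mk⇔ (s≤s ∘ to e ∘ s≤s⁻¹) (s≤s ∘ from e ∘ s≤s⁻¹)
  shrink-near (suc (suc t)) {suc a} {0} fa fb =
    let e = shrink-bottom t fa in mk⇔ (s≤s ∘ to e ∘ s≤s⁻¹) (s≤s ∘ from e ∘ s≤s⁻¹)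
  shrink-near (suc (suc t)) {suc a} {suc b} fa fb = shrink-near (suc t) fa fb

  -- Level lists of lollipops and their contraction.

  filter-map : ∀ {A B : Set} {P : B → Set} (P? : Decidable P) (f : A → B) xs →
               filter P? (map f xs) ≡ map f (filter (P? ∘ f) xs)
  filter-map P? f []       = refl
  filter-map P? f (x ∷ xs) with does (P? (f x))
  ... | true  = cong (f x ∷_) (filter-map P? f xs)
  ... | false = filter-map P? f xs

  -- The levels of a lollipop: one path vertex on each level below d, and the
  -- clique on level d.
  levels : ℕ → ℕ → List ℕ
  levels zero    c = replicate c 0
  levels (suc d) c = 0 ∷ map suc (levels d c)

  path-clique-levels : ∀ d c → map toℕ (allFin d) ++ replicate c d ≡ levels d c
  path-clique-levels zero    c = refl
  path-clique-levels (suc d) c = cong (0 ∷_) (begin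
    map toℕ (tabulate suc) ++ replicate c (suc d)
      ≡⟨ cong₂ _++_ heights (sym (map-replicate suc c d)) ⟩
    map suc (map toℕ (allFin d)) ++ map suc (replicate c d)
      ≡⟨ map-++ suc (map toℕ (allFin d)) _ ⟨
    map suc (map toℕ (allFin d) ++ replicate c d)
      ≡⟨ cong (map suc) (path-clique-levels d c) ⟩
    map suc (levels d c) ∎)
    where
    open ≡-Reasoning
    heights : map toℕ (tabulate suc) ≡ map suc (map toℕ (allFin d))
    heights = trans (map-tabulate suc toℕ)
      (sym (trans (cong (map suc) (map-tabulate id toℕ)) (map-tabulate toℕ suc)))

  length-levels : ∀ d c → length (levels d c) ≡ d + c
  length-levels zero    c = length-replicate c
  length-levels (suc d) c = cong suc (trans (length-map suc (levels d c)) (length-levels d c))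

  collapse : ℕ → List ℕ → List ℕ
  collapse t L = pred t ∷ map (shrink t) (filter (far? t) L)

  collapse-↭ : ∀ t {L M} → L ↭ M → collapse t L ↭ collapse t M
  collapse-↭ t L↭M = prep _ (map⁺ (shrink t) (filter-↭ (far? t) L↭M))

  -- The inductive step for centres further up: a new bottom level is far from `2 + t` and survives
  -- unchanged. It trades places with the new vertex at the head of the list, hence a permutation.
  collapse-suc : ∀ t L {M} → collapse (suc t) L ↭ M →
                 collapse (suc (suc t)) (0 ∷ map suc L) ↭ 0 ∷ map suc M
  collapse-suc t L {M} L↭M = begin
    suc t ∷ 0 ∷ map (shrink (2 + t)) (filter (far? (2 + t)) (map suc L))
      ≡⟨ cong (λ N → suc t ∷ 0 ∷ map (shrink (2 + t)) N) (filter-map (far? (2 + t)) suc L) ⟩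
    suc t ∷ 0 ∷ map (shrink (2 + t)) (map suc F)
      ≡⟨ cong (λ N → suc t ∷ 0 ∷ N) (trans (sym (map-∘ F)) (map-∘ F)) ⟩
    suc t ∷ 0 ∷ map suc (map (shrink (suc t)) F)
      ↭⟨ swap _ _ ↭-refl ⟩
    0 ∷ map suc (collapse (suc t) L)
      ↭⟨ prep 0 (map⁺ suc L↭M) ⟩
    0 ∷ map suc M ∎
    where
    open PermutationReasoning
    F = filter (far? (suc t)) L

  -- Levels 0 and 1 merge. Both lie on the path, so the path loses one vertex and the clique is
  -- kept.
  collapse-first : ∀ e c → collapse 0 (levels (2 + e) c) ↭ levels (1 + e) c
  collapse-first e c = ↭-reflexive (cong (0 ∷_) (begin
    map (shrink 0) (filter (far? 0) (map suc (map suc L)))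
      ≡⟨ cong (map (shrink 0) ∘ filter (far? 0)) (map-∘ L) ⟨
    map (shrink 0) (filter (far? 0) (map (2 +_) L))
      ≡⟨ cong (map (shrink 0)) (filter-all (far? 0) (All.map⁺ (All.universal (λ { _ (s≤s ()) }) L))) ⟩
    map (shrink 0) (map (2 +_) L)
      ≡⟨ map-∘ L ⟨
    map suc L ∎))
    where
    open ≡-Reasoning
    L = levels e c

  -- The bound `t < m` keeps the upper neighbour, of level `2 + t`, below the clique: three path
  -- vertices become one.
  collapse-middle : ∀ t {m} c → t < m → collapse (suc t) (levels (2 + m) c) ↭ levels m c
  collapse-middle zero {suc m} c _ = ↭-reflexive (cong (0 ∷_) (begin
    map (shrink 1) (filter (far? 1) (map suc (map suc (map suc L))))
      ≡⟨ cong (map (shrink 1) ∘ filter (far? 1)) (trans (map-∘ {g = suc} {f = 2 +_} L) (cong (map suc) (map-∘ L))) ⟨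
    map (shrink 1) (filter (far? 1) (map (3 +_) L))
      ≡⟨ cong (map (shrink 1)) (filter-all (far? 1) (All.map⁺ (All.universal (λ { _ (s≤s ()) }) L))) ⟩
    map (shrink 1) (map (3 +_) L)
      ≡⟨ map-∘ L ⟨
    map suc L ∎))
    where
    open ≡-Reasoning
    L = levels m c
  collapse-middle (suc t) {suc m} c (s≤s t<m) = collapse-suc t (levels (2 + m) c) (collapse-middle t c t<m)

  -- The whole clique and the last two path vertices merge, and the new vertex ends a path.
  collapse-last : ∀ t c → collapse (suc t) (levels (2 + t) c) ↭ levels (1 + t) 0
  collapse-last zero c = ↭-reflexive (cong (λ L → 0 ∷ map (shrink 1) L)
    (filter-none (far? 1) (All.map⁺ (All.map⁺ (All.replicate⁺ c λ far → far ≤-refl)))))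
  collapse-last (suc t) c = collapse-suc t (levels (2 + t) c) (collapse-last t c)

  -- The clique merges with the last path vertex only, so the resulting path is as long as the
  -- original one.
  collapse-clique : ∀ t c → collapse (suc t) (levels (suc t) c) ↭ levels (suc t) 0
  collapse-clique zero c = ↭-reflexive (cong (λ L → 0 ∷ map (shrink 1) L)
    (filter-none (far? 1) (All.map⁺ (All.replicate⁺ c λ far → far z≤n))))
  collapse-clique (suc t) c = collapse-suc t (levels (1 + t) c) (collapse-clique t c)

  -- With no hole below an occupied level, a walk can change its level by one at a time.
  Interval : List ℕ → Set
  Interval L = ∀ {a b} → b ∈ L → a ≤ b → a ∈ L

  levels-interval : ∀ d c → Interval (levels d c)
  levels-interval zero c {a} {b} b∈ a≤b with All.lookup (All.replicate⁺ {P = _≡ 0} c refl) b∈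
  levels-interval zero c {zero} b∈ z≤n | refl = b∈
  levels-interval (suc d) c {zero} b∈ a≤b = here refl
  levels-interval (suc d) c {suc a} (here refl) ()
  levels-interval (suc d) c {suc a} (there b∈) a≤b
    with ∈-map⁻ suc b∈
  ... | b , b∈′ , refl = there (∈-map⁺ suc (levels-interval d c b∈′ (s≤s⁻¹ a≤b)))

  -- Sums of gaps over level lists.

  gap : ℕ → ℕ → ℕ
  gap a b = 1 ⊔ ∣ a - b ∣

  -- The diagonal is included; each of its entries contributes 1, so this will be the total distance
  -- plus the order.
  pairSum : List ℕ → ℕ
  pairSum L = sum (map (λ a → sum (map (gap a) L)) L)

  pairSum-↭ : ∀ {L M} → L ↭ M → pairSum L ≡ pairSum M
  pairSum-↭ {L} {M} p = trans
    (cong sum (map-cong (λ a → sum-↭ (map⁺ (gap a) p)) L))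
    (sum-↭ (map⁺ _ p))

  sum-map-+ : ∀ {A : Set} (f g : A → ℕ) xs →
              sum (map (λ x → f x + g x) xs) ≡ sum (map f xs) + sum (map g xs)
  sum-map-+ f g []       = refl
  sum-map-+ f g (x ∷ xs) = trans (cong (f x + g x +_) (sum-map-+ f g xs))
    (interchange (f x) (g x) (sum (map f xs)) (sum (map g xs)))
    where
    interchange : ∀ a b c d → a + b + (c + d) ≡ a + c + (b + d)
    interchange = ℕ.solve-∀

  -- Raising all levels by one preserves gaps. The new level 0 adds 1 on the diagonal and, in both
  -- orders, the gap `suc a` to each raised level.
  pairSum-∷ : ∀ L → pairSum (0 ∷ map suc L) ≡ 1 + 2 * sum (map suc L) + pairSum L
  pairSum-∷ L = begin
    suc (sum (map (gap 0) (map suc L))) + sum (map row (map suc L))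
      ≡⟨ cong₂ (λ x y → suc (sum x) + sum y) (map-∘ {g = gap 0} L) (map-∘ L) ⟨
    suc (sum (map suc L)) + sum (map (λ a → suc a + sum (map (gap (suc a)) (map suc L))) L)
      ≡⟨ cong (λ x → suc (sum (map suc L)) + sum x)
           (map-cong (λ a → cong (λ x → suc a + sum x) (sym (map-∘ L))) L) ⟩
    suc (sum (map suc L)) + sum (map (λ a → suc a + sum (map (gap a) L)) L)
      ≡⟨ cong (suc (sum (map suc L)) +_) (sum-map-+ suc (λ a → sum (map (gap a) L)) L) ⟩
    suc (sum (map suc L)) + (sum (map suc L) + pairSum L)
      ≡⟨ regroup (sum (map suc L)) (pairSum L) ⟩
    1 + 2 * sum (map suc L) + pairSum L ∎
    where
    open ≡-Reasoning
    row : ℕ → ℕ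
    row a = sum (map (gap a) (0 ∷ map suc L))
    regroup : ∀ x y → suc x + (x + y) ≡ 1 + 2 * x + y
    regroup = ℕ.solve-∀

  sum-suc : ∀ (L : List ℕ) → sum (map suc L) ≡ length L + sum L
  sum-suc []      = refl
  sum-suc (x ∷ L) = cong suc (trans (cong (x +_) (sum-suc L)) (regroup x (length L) (sum L)))
    where
    regroup : ∀ x y z → x + (y + z) ≡ y + (x + z)
    regroup = ℕ.solve-∀

  -- Doubled, so that the triangular number needs no division.
  sum-levels : ∀ d c → 2 * sum (map suc (levels d c)) ≡ d * (1 + d) + 2 * c * (1 + d)
  sum-levels zero c = trans (cong (2 *_) (ones c)) (base c)
    where
    ones : ∀ c → sum (map suc (replicate c 0)) ≡ c
    ones zero    = refl
    ones (suc c) = cong suc (ones c)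
    base : ∀ c → 2 * c ≡ 0 * 1 + 2 * c * 1
    base = ℕ.solve-∀
  sum-levels (suc d) c = begin
    2 * suc (sum (map suc M))                    ≡⟨ cong (λ x → 2 * suc x) (sum-suc M) ⟩
    2 * suc (length M + sum M)
      ≡⟨ cong (λ x → 2 * suc (x + sum M)) (trans (length-map suc (levels d c)) (length-levels d c)) ⟩
    2 * suc (d + c + sum M)                      ≡⟨ expand d c (sum M) ⟩
    2 + 2 * d + 2 * c + 2 * sum M                ≡⟨ cong (2 + 2 * d + 2 * c +_) (sum-levels d c) ⟩
    2 + 2 * d + 2 * c + (d * (1 + d) + 2 * c * (1 + d)) ≡⟨ collect d c ⟩
    (1 + d) * (2 + d) + 2 * c * (2 + d) ∎
    where
    open ≡-Reasoning
    M = map suc (levels d c)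
    expand : ∀ d c x → 2 * suc (d + c + x) ≡ 2 + 2 * d + 2 * c + 2 * x
    expand = ℕ.solve-∀
    collect : ∀ d c → 2 + 2 * d + 2 * c + (d * (1 + d) + 2 * c * (1 + d)) ≡ (1 + d) * (2 + d) + 2 * c * (2 + d)
    collect = ℕ.solve-∀

  -- Tripled to clear denominators. Removing the diagonal `3 (d + c)` leaves
  -- `3 c (d² - 1 + d + c) + d (d² - 1)`.
  pairSum-levels : ∀ d c →
    3 * pairSum (levels d c) ≡ d * d * d + 2 * d + 3 * c * (d * d + d + c)
  pairSum-levels zero c = trans (cong (3 *_) (square c c)) (base c)
    where
    ones : ∀ c → sum (map (gap 0) (replicate c 0)) ≡ c
    ones zero    = refl
    ones (suc c) = cong suc (ones c)
    square : ∀ b c → sum (map (λ a → sum (map (gap a) (replicate c 0))) (replicate b 0)) ≡ b * c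
    square zero    c = refl
    square (suc b) c = cong₂ _+_ (ones c) (square b c)
    base : ∀ c → 3 * (c * c) ≡ 0 * 0 * 0 + 2 * 0 + 3 * c * (0 * 0 + 0 + c)
    base = ℕ.solve-∀
  pairSum-levels (suc d) c = begin
    3 * pairSum (levels (suc d) c)
      ≡⟨ cong (3 *_) (pairSum-∷ (levels d c)) ⟩
    3 * (1 + 2 * P + pairSum (levels d c))
      ≡⟨ *-distribˡ-+ 3 (1 + 2 * P) (pairSum (levels d c)) ⟩
    3 * (1 + 2 * P) + 3 * pairSum (levels d c)
      ≡⟨ cong₂ (λ x y → 3 * (1 + x) + y) (sum-levels d c) (pairSum-levels d c) ⟩
    3 * (1 + (d * (1 + d) + 2 * c * (1 + d))) + (d * d * d + 2 * d + 3 * c * (d * d + d + c))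
      ≡⟨ collect d c ⟩
    suc d * suc d * suc d + 2 * suc d + 3 * c * (suc d * suc d + suc d + c) ∎
    where
    open ≡-Reasoning
    P = sum (map suc (levels d c))
    collect : ∀ d c → 3 * (1 + (d * (1 + d) + 2 * c * (1 + d))) + (d * d * d + 2 * d + 3 * c * (d * d + d + c))
              ≡ suc d * suc d * suc d + 2 * suc d + 3 * c * (suc d * suc d + suc d + c)
    collect = ℕ.solve-∀

  -- Repetition-free lists and levelled graphs.

  unique-map : ∀ {A B : Set} {P : A → Set} {f : A → B} →
               (∀ {x y} → P x → P y → f x ≡ f y → x ≡ y) →
               ∀ {xs} → All P xs → Unique xs → Unique (map f xs)
  unique-map inj []         []       = []
  unique-map inj (px ∷ pxs) (x∉ ∷ u) =
    All.map⁺ (All.zipWith (λ (py , x≢y) e → x≢y (inj px py e)) (pxs , x∉)) ∷ unique-map inj pxs u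

  complete⇒↭ : ∀ {A : Set} {xs ys : List A} → Unique xs → Unique ys →
                (∀ x → x ∈ xs) → (∀ y → y ∈ ys) → xs ↭ ys
  complete⇒↭ uxs uys ∈xs ∈ys = ∼bag⇒↭ (unique∧set⇒bag uxs uys (mk⇔ (λ _ → ∈ys _) (λ _ → ∈xs _)))

  -- Isolates the diagonal term in a row of distances.
  remove-unique : ∀ {A : Set} {P : A → Set} (P? : Decidable P) {x xs} → x ∈ xs → Unique xs →
                  ¬ P x → (∀ {y} → x ≢ y → P y) → xs ↭ x ∷ filter P? xs
  remove-unique P? {x} {_ ∷ xs} (here refl) (x∉ ∷ u) ¬px others = prep x (↭-reflexive (sym (trans
    (filter-reject P? ¬px) (filter-all P? (All.map others x∉)))))
  remove-unique P? {x} {y ∷ xs} (there x∈) (y∉ ∷ u) ¬px others = ↭-trans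
    (prep y (remove-unique P? x∈ u ¬px others))
    (↭-trans (swap y x ↭-refl) (prep x (↭-reflexive (sym (filter-accept P? (others (≢-sym (All.lookup y∉ x∈))))))))

  -- Adjacency is compared with nearness for distinct vertices only, since nearness is reflexive.
  -- The levels are fixed up to order, as only their multiset enters the total distance.
  record Levelling (G : Graph) (L : List ℕ) : Set where
    open Graph G
    field
      level    : V → ℕ
      adj-near : ∀ {u v} → u ≢ v → Adj u v ⇔ Near (level u) (level v)
      level-↭  : map level nodes ↭ L

    order-length : order ≡ length L
    order-length = trans (sym (length-map level nodes)) (↭-length level-↭)

  -- Distances in a levelled graph.

  module _ {G : Graph} {L : List ℕ} (ℓ : Levelling G L) (interval : Interval L) where
    open Graph G
    open Levelling ℓ hiding (order-length)

    adj⇒near : ∀ {u v} → Adj u v → Near (level u) (level v)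
    adj⇒near a = to (adj-near λ { refl → irrefl a }) a

    attained : ∀ {a} v → a ≤ level v → ∃[ w ] level w ≡ a
    attained v a≤ with ∈-map⁻ level (∈-resp-↭ (↭-sym level-↭)
                         (interval (∈-resp-↭ level-↭ (∈-map⁺ level (complete v))) a≤))
    ... | w , _ , refl = w , refl

    attained-⊔ : ∀ {a} u v → a ≤ level u ⊔ level v → ∃[ w ] level w ≡ a
    attained-⊔ u v a≤ with ⊔-sel (level u) (level v)
    ... | inj₁ e = attained u (≤-trans a≤ (≤-reflexive e))
    ... | inj₂ e = attained v (≤-trans a≤ (≤-reflexive e))

    level-≢ : ∀ {u w v k} → ∣ level u - level v ∣ ≡ suc k → ∣ level w - level v ∣ ≡ k → u ≢ w
    level-≢ e e′ refl = 1+n≢n (trans (sym e) e′)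

    -- Each step moves one level closer to `v`, through a vertex that exists because the levels form
    -- an interval.
    walk : ∀ k {u v} → ∣ level u - level v ∣ ≡ suc k → Walk (suc k) u v
    walk zero    {u} {v} e = from (adj-near u≢v) (≤-reflexive e) ∷ []
      where
      u≢v : u ≢ v
      u≢v refl with trans (sym e) (∣n-n∣≡0 (level u))
      ... | ()
    walk (suc k) {u} {v} e with between (level u) (level v) e
    ... | a , near , rest , a≤ with attained-⊔ u v a≤
    ... | w , refl = from (adj-near (level-≢ e rest)) near ∷ walk k rest

    -- An edge changes the level by at most 1, and the triangle inequality adds these changes up.
    walk-bound : ∀ {k u v} → Walk k u v → ∣ level u - level v ∣ ≤ k
    walk-bound {u = u} [] = ≤-reflexive (∣n-n∣≡0 (level u))
    walk-bound {u = u} {w} (_∷_ {v = v} a p) = ≤-trans (∣-∣-triangle (level u) (level v) (level w))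
      (+-mono-≤ (adj⇒near a) (walk-bound p))

    walk-gap : ∀ {u v} → u ≢ v → Walk (gap (level u) (level v)) u v
    walk-gap {u} {v} u≢v with ∣ level u - level v ∣ in e
    -- Distinct vertices on one level are adjacent; this is the case for which `gap` is bounded
    -- below by 1.
    ... | zero  = from (adj-near u≢v) (≤-trans (≤-reflexive e) z≤n) ∷ []
    ... | suc k = walk k e

    gap-bound : ∀ {k u v} → u ≢ v → Walk k u v → gap (level u) (level v) ≤ k
    gap-bound u≢v []          = contradiction refl u≢v
    gap-bound u≢v p@(_ ∷ _) = ⊔-lub (s≤s z≤n) (walk-bound p)

    -- Total distance as a sum of gaps.

    module _ (conn : Connected) where

      dist-gap : ∀ {u v} → u ≢ v → dist G conn u v ≡ gap (level u) (level v)
      dist-gap {u} {v} u≢v with shortest G conn u v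
      ... | k , p , min = ≤-antisym (min (walk-gap u≢v)) (gap-bound u≢v p)

      private
        distinct? : Decidable (λ ((u , v) : V × V) → u ≢ v)
        distinct? (u , v) = ¬? (u ≟ v)

        d : V × V → ℕ
        d (u , v) = dist G conn u v

      -- The extra `suc` is the diagonal pair `(u , u)`, whose gap is 1 and which `totalDistance`
      -- filters out.
      row-sum : ∀ u → sum (map (gap (level u) ∘ level) nodes) ≡
                      suc (sum (map d (filter distinct? (map (u ,_) nodes))))
      row-sum u = begin
        sum (map (gap (level u) ∘ level) nodes)
          ≡⟨ sum-↭ (map⁺ _ (remove-unique (distinct? ∘ (u ,_)) (complete u) unique (λ u≢u → u≢u refl) id)) ⟩
        gap (level u) (level u) + sum (map (gap (level u) ∘ level) F)
          ≡⟨ cong₂ _+_ (cong (1 ⊔_) (∣n-n∣≡0 (level u)))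
               (cong sum (map-cong-local (All.map (λ u≢v → sym (dist-gap u≢v))
                                                  (All.all-filter (distinct? ∘ (u ,_)) nodes)))) ⟩
        suc (sum (map (dist G conn u) F))
          ≡⟨ cong (suc ∘ sum) (trans (map-∘ F) (cong (map d) (sym (filter-map distinct? (u ,_) nodes)))) ⟩
        suc (sum (map d (filter distinct? (map (u ,_) nodes)))) ∎
        where
        open ≡-Reasoning
        F = filter (distinct? ∘ (u ,_)) nodes

      -- The row index runs over an arbitrary list, so that induction can shorten it while the
      -- columns stay fixed; `length us` counts the diagonal pairs.
      rows-sum : ∀ us → sum (map (λ u → sum (map (gap (level u) ∘ level) nodes)) us) ≡
                        sum (map d (filter distinct? (cartesianProduct us nodes))) + length us
      rows-sum []       = refl
      rows-sum (u ∷ us) = begin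
        sum (map (gap (level u) ∘ level) nodes) + sum (map (λ u → sum (map (gap (level u) ∘ level) nodes)) us)
          ≡⟨ cong₂ _+_ (row-sum u) (rows-sum us) ⟩
        suc (sum (map d (filter distinct? row))) + (sum (map d (filter distinct? rest)) + length us)
          ≡⟨ regroup (sum (map d (filter distinct? row))) _ _ ⟩
        sum (map d (filter distinct? row)) + sum (map d (filter distinct? rest)) + suc (length us)
          ≡⟨ cong (_+ suc (length us)) (sum-++ (map d (filter distinct? row)) _) ⟨
        sum (map d (filter distinct? row) ++ map d (filter distinct? rest)) + suc (length us)
          ≡⟨ cong (λ xs → sum xs + suc (length us)) (map-++ d (filter distinct? row) _) ⟨
        sum (map d (filter distinct? row ++ filter distinct? rest)) + suc (length us)
          ≡⟨ cong (λ xs → sum (map d xs) + suc (length us)) (filter-++ distinct? row rest) ⟨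
        sum (map d (filter distinct? (row ++ rest))) + suc (length us) ∎
        where
        open ≡-Reasoning
        row = map (u ,_) nodes
        rest = cartesianProduct us nodes
        regroup : ∀ a b c → suc a + (b + c) ≡ a + b + suc c
        regroup = ℕ.solve-∀

      totalDistance-pairSum : totalDistance G conn + order ≡ pairSum L
      totalDistance-pairSum = begin
        totalDistance G conn + order
          ≡⟨ rows-sum nodes ⟨
        sum (map (λ u → sum (map (gap (level u) ∘ level) nodes)) nodes)
          ≡⟨ cong sum (map-cong (λ u → cong sum (map-∘ nodes)) nodes) ⟩
        sum (map (λ u → sum (map (gap (level u)) (map level nodes))) nodes)
          ≡⟨ cong sum (map-∘ nodes) ⟩
        pairSum (map level nodes)
          ≡⟨ pairSum-↭ level-↭ ⟩
        pairSum L ∎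
        where open ≡-Reasoning

    -- Levelling of a contracted graph.

    module _ (v : V) where
      open Contraction G v hiding (contract)

      private
        t : ℕ
        t = level v

      closed-near : ∀ w → Closed w ⇔ Near t (level w)
      closed-near w = mk⇔
        (λ { (inj₁ refl) → ≤-trans (≤-reflexive (∣n-n∣≡0 t)) z≤n ; (inj₂ a) → adj⇒near a })
        back
        where
        back : Near t (level w) → Closed w
        back near with w ≟ v
        ... | yes e  = inj₁ e
        ... | no w≢v = inj₂ (from (adj-near (≢-sym w≢v)) near)

      remaining-far : ∀ {w} → ¬ Closed w → Far t (level w)
      remaining-far {w} ¬c = ¬c ∘ from (closed-near w)

      far-remaining : ((w , _) : Remaining) → Far t (level w)
      far-remaining (_ , p) = remaining-far (toWitnessFalse p)

      level′ : V′ → ℕ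
      level′ nothing        = pred t
      level′ (just (w , _)) = shrink t (level w)

      -- A remaining vertex touches the contracted neighbourhood exactly when its level is at gap 2
      -- from `t`, and `far-shrink` turns this into gap 1 from the new vertex.
      new-adj : ∀ {w} → ¬ Closed w →
                (∃[ x ] Closed x × Adj x w) ⇔ Near (pred t) (shrink t (level w))
      new-adj {w} ¬c = mk⇔ there′ back
        where
        far : Far t (level w)
        far = remaining-far ¬c
        there′ : (∃[ x ] Closed x × Adj x w) → Near (pred t) (shrink t (level w))
        there′ (x , c , a) = s≤s⁻¹ (subst (_≤ 2) (far-shrink t far)
          (≤-trans (∣-∣-triangle t (level x) (level w)) (+-mono-≤ (to (closed-near x) c) (adj⇒near a))))
        back : Near (pred t) (shrink t (level w)) → (∃[ x ] Closed x × Adj x w)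
        -- The witness is a vertex one level from `v` towards `w`: it is in the closed
        -- neighbourhood, and its gap to `w` equals the shrunk gap.
        back near with between t (level w) (far-shrink t far)
        ... | a , near-a , rest , a≤ with attained-⊔ v w a≤
        ... | x , refl = x , c , from (adj-near (λ { refl → ¬c c })) (≤-trans (≤-reflexive rest) near)
          where c = from (closed-near x) near-a

      adj-near′ : ∀ {a b} → a ≢ b → Adj′ a b ⇔ Near (level′ a) (level′ b)
      adj-near′ {nothing} {nothing} a≢b = contradiction refl a≢b
      adj-near′ {nothing} {just (w , p)} a≢b = new-adj (toWitnessFalse p)
      adj-near′ {just (w , p)} {nothing} a≢b =
        let e = new-adj (toWitnessFalse p)
        in mk⇔ (near-sym {pred t} ∘ to e) (from e ∘ near-sym {_} {pred t})
      adj-near′ {just r@(w , p)} {just r′@(x , q)} a≢b =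
        let e = adj-near (λ w≡x → a≢b (cong just (remaining-≡ w≡x)))
            s = shrink-near t (far-remaining r) (far-remaining r′)
        in mk⇔ (to s ∘ to e) (from e ∘ from s)

      private
        remaining? : Decidable (λ w → ¬ Closed w)
        remaining? = ¬? ∘ closed?

      project-remaining : ∀ {w} (¬c : ¬ Closed w) → project w ≡ just (w , fromWitnessFalse ¬c)
      project-remaining {w} ¬c = class-remaining (closed? w) (fromWitnessFalse ¬c)

      project-injective : ∀ {w x} → ¬ Closed w → ¬ Closed x → project w ≡ project x → w ≡ x
      project-injective ¬c ¬c′ e
        with trans (sym (project-remaining ¬c)) (trans e (project-remaining ¬c′))
      ... | refl = refl

      -- Both lists are complete and free of repetitions, so the deduplicated one may be replaced by
      -- one with the new vertex in front. Injectivity of `project` is used only off the contracted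
      -- neighbourhood.
      nodes′-↭ : nodes′ ↭ nothing ∷ map project (filter remaining? nodes)
      nodes′-↭ = complete⇒↭ (Graph.unique (contract G v))
        (All.map⁺ (All.map (λ ¬c e → nothing≢just (trans e (project-remaining ¬c))) remaining)
          ∷ unique-map project-injective remaining (Unique.filter⁺ remaining? unique))
        complete′
        found
        where
        remaining = All.all-filter remaining? nodes
        nothing≢just : ∀ {r : Remaining} → nothing ≢ just r
        nothing≢just ()
        found : ∀ a → a ∈ nothing ∷ map project (filter remaining? nodes)
        found nothing = here refl
        found (just (w , p)) = there (subst (_∈ map project (filter remaining? nodes))
          (class-remaining (closed? w) p)
          (∈-map⁺ project (∈-filter⁺ remaining? (complete w) (toWitnessFalse p))))

      contract-levelling : Levelling (contract G v) (collapse t L)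
      contract-levelling = record
        { level = level′
        ; adj-near = λ {a} {b} → adj-near′ {a} {b}
        ; level-↭ = begin
            map level′ nodes′
              ↭⟨ map⁺ level′ nodes′-↭ ⟩
            pred t ∷ map level′ (map project F)
              ≡⟨ cong (pred t ∷_) (map-∘ F) ⟨
            pred t ∷ map (level′ ∘ project) F
              ≡⟨ cong (pred t ∷_) (map-cong-local (All.map (λ ¬c → cong level′ (project-remaining ¬c))
                   (All.all-filter remaining? nodes))) ⟩
            pred t ∷ map (shrink t ∘ level) F
              ≡⟨ cong (λ xs → pred t ∷ map (shrink t ∘ level) xs)
                   (filter-≐ remaining? (far? t ∘ level)
                     ((λ {w} ¬c → ¬c ∘ from (closed-near w)) , (λ {w} far → far ∘ to (closed-near w))) nodes) ⟩
            pred t ∷ map (shrink t ∘ level) (filter (far? t ∘ level) nodes)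
              ≡⟨ cong (pred t ∷_) (map-∘ _) ⟩
            pred t ∷ map (shrink t) (map level (filter (far? t ∘ level) nodes))
              ≡⟨ cong (λ xs → pred t ∷ map (shrink t) xs) (filter-map (far? t) level nodes) ⟨
            collapse t (map level nodes)
              ↭⟨ collapse-↭ t level-↭ ⟩
            collapse t L ∎
        }
        where
        open PermutationReasoning
        F = filter remaining? nodes

  relevel : ∀ {G L M} → L ↭ M → Levelling G L → Levelling G M
  relevel L↭M ℓ = record { Levelling ℓ ; level-↭ = ↭-trans (Levelling.level-↭ ℓ) L↭M }

  -- Levelling of the lollipop.

  module _ (n d : ℕ) where

    height : Lollipop.V n d → ℕ
    height (path i)   = toℕ i
    height (clique _) = d

    -- Path levels lie strictly below `d`, so the only one near the clique level is `d - 1`, that of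
    -- `v_d`.
    last-near : ∀ {i : Fin d} → index i ≡ d ⇔ Near (toℕ i) d
    last-near {i} = mk⇔ (suc-near ∘ sym) back
      where
      back : Near (toℕ i) d → index i ≡ d
      back near with near-suc (<⇒≢ (Fin.toℕ<n i)) near
      ... | inj₁ e = sym e
      ... | inj₂ e = contradiction (≤-reflexive (sym e)) (<-asym (Fin.toℕ<n i))

    height-adj : ∀ {a b} → a ≢ b → Lollipop.Adj n d a b ⇔ Near (height a) (height b)
    height-adj {path i} {path j} a≢b = mk⇔
      (λ { (inj₁ e) → suc-near (suc-injective e)
         ; (inj₂ e) → near-sym {toℕ j} (suc-near (suc-injective e)) })
      back
      where
      back : Near (toℕ i) (toℕ j) → _
      back near with near-suc (λ e → a≢b (cong inj₁ (Fin.toℕ-injective e))) near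
      ... | inj₁ e = inj₁ (cong suc e)
      ... | inj₂ e = inj₂ (cong suc e)
    height-adj {path i} {clique j} a≢b = last-near
    height-adj {clique i} {path j} a≢b = mk⇔
      (near-sym {toℕ j} ∘ to last-near) (from last-near ∘ near-sym {_} {toℕ j})
    height-adj {clique i} {clique j} a≢b = mk⇔
      (λ _ → ≤-trans (≤-reflexive (∣n-n∣≡0 d)) z≤n) (λ _ → a≢b ∘ cong inj₂)

    lollipop-levelling : Levelling (lollipop n d) (levels d (n ∸ d))
    lollipop-levelling = record
      { level = height
      ; adj-near = height-adj
      ; level-↭ = ↭-reflexive (begin
          map height (map inj₁ (allFin d) ++ map inj₂ (allFin (n ∸ d)))
            ≡⟨ map-++ height (map inj₁ (allFin d)) _ ⟩
          map height (map inj₁ (allFin d)) ++ map height (map inj₂ (allFin (n ∸ d)))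
            ≡⟨ cong₂ _++_ (map-∘ (allFin d)) (map-∘ (allFin (n ∸ d))) ⟨
          map toℕ (allFin d) ++ map (λ _ → d) (allFin (n ∸ d))
            ≡⟨ cong (map toℕ (allFin d) ++_) (constant (n ∸ d)) ⟩
          map toℕ (allFin d) ++ replicate (n ∸ d) d
            ≡⟨ path-clique-levels d (n ∸ d) ⟩
          levels d (n ∸ d) ∎)
      }
      where
      open ≡-Reasoning
      constant : ∀ c → map (λ (_ : Fin c) → d) (allFin c) ≡ replicate c d
      constant c = trans (map-tabulate id (λ _ → d)) (consts c)
        where
        consts : ∀ c → tabulate {n = c} (λ _ → d) ≡ replicate c d
        consts zero    = refl
        consts (suc c) = cong (d ∷_) (consts c)

-- Rational arithmetic and total division.

open import Data.Integer.Base as ℤ using (+_)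
open import Data.Rational.Base using (ℚ; 0ℚ; 1ℚ; 1/_; _+_; _-_; _*_; ≢-nonZero)
-- All denominators are 1, so in unnormalised form this is an identity of integers.
fromℕℚ-+ : ∀ m n → fromℕℚ (m ℕ.+ n) ≡ fromℕℚ m + fromℕℚ n
fromℕℚ-+ m n = ℚ.toℚᵘ-injective (ℚᵘ.≃-trans
  (ℚᵘ.*≡* (trans (cong (ℤ._* (+ 1)) (ℤ.pos-+ m n)) (unit (+ m) (+ n))))
  (ℚᵘ.≃-sym (ℚ.toℚᵘ-homo-+ (fromℕℚ m) (fromℕℚ n))))
  where
  unit : ∀ x y → (x ℤ.+ y) ℤ.* (+ 1) ≡ (x ℤ.* (+ 1) ℤ.+ y ℤ.* (+ 1)) ℤ.* (+ 1)
  unit = ℤ.solve-∀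

fromℕℚ-* : ∀ m n → fromℕℚ (m ℕ.* n) ≡ fromℕℚ m * fromℕℚ n
fromℕℚ-* m n = ℚ.toℚᵘ-injective (ℚᵘ.≃-trans
  (ℚᵘ.*≡* (cong (ℤ._* (+ 1)) (ℤ.pos-* m n)))
  (ℚᵘ.≃-sym (ℚ.toℚᵘ-homo-* (fromℕℚ m) (fromℕℚ n))))

fromℕℚ-injective : ∀ {m n} → fromℕℚ m ≡ fromℕℚ n → m ≡ n
fromℕℚ-injective refl = refl

÷₀-cancel : ∀ p {q} → q ≢ 0ℚ → (p ÷₀ q) * q ≡ p
÷₀-cancel p {q} q≢0 with q ℚ.≟ 0ℚ
... | yes q≡0 = contradiction q≡0 q≢0
... | no  q≢0 = begin
  p * (1/ q) * q   ≡⟨ ℚ.*-assoc p (1/ q) q ⟩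
  p * ((1/ q) * q) ≡⟨ cong (p *_) (ℚ.*-inverseˡ q) ⟩
  p * 1ℚ           ≡⟨ ℚ.*-identityʳ p ⟩
  p ∎
  where
  open ≡-Reasoning
  instance _ = ≢-nonZero q≢0

*-cancelʳ : ∀ {p q} r → r ≢ 0ℚ → p * r ≡ q * r → p ≡ q
*-cancelʳ {p} {q} r r≢0 pr≡qr = begin
  p               ≡⟨ divide p ⟨
  p * r * (1/ r)  ≡⟨ cong (_* (1/ r)) pr≡qr ⟩
  q * r * (1/ r)  ≡⟨ divide q ⟩
  q ∎
  where
  open ≡-Reasoning
  instance _ = ≢-nonZero r≢0
  divide : ∀ p → p * r * (1/ r) ≡ p
  divide p = trans (ℚ.*-assoc p r (1/ r)) (trans (cong (p *_) (ℚ.*-inverseʳ r)) (ℚ.*-identityʳ p))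

÷₀-unique : ∀ {p q r} → q ≢ 0ℚ → r * q ≡ p → r ≡ p ÷₀ q
÷₀-unique {p} {q} q≢0 e = *-cancelʳ q q≢0 (trans e (sym (÷₀-cancel p q≢0)))

ring : AlmostCommutativeRing 0ℓ 0ℓ
ring = fromCommutativeRing ℚ.+-*-commutativeRing (dec⇒weaklyDec ℚ._≟_ 0ℚ)

*-nonzero : ∀ {p q} → p ≢ 0ℚ → q ≢ 0ℚ → p * q ≢ 0ℚ
*-nonzero {q = q} p≢0 q≢0 pq≡0 = p≢0 (*-cancelʳ q q≢0 (trans pq≡0 (sym (ℚ.*-zeroˡ q))))

factorˡ-nonzero : ∀ {p q} → p * q ≢ 0ℚ → p ≢ 0ℚ
factorˡ-nonzero {q = q} pq≢0 refl = pq≢0 (ℚ.*-zeroˡ q)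

factorʳ-nonzero : ∀ {p q} → p * q ≢ 0ℚ → q ≢ 0ℚ
factorʳ-nonzero {p} pq≢0 refl = pq≢0 (ℚ.*-zeroʳ p)

-- Agglomeration and importance from levels.

Q : ℚ → ℚ → ℚ
Q N D = 3 * (N - D) * (D * D - 1 + N) + D * (D * D - 1)

-- Writing the path length as `2 + e` makes the order exceed 1, which selects the quotient branch of
-- `φ`, and makes the total distance nonzero.
module LollipopLevels {G : Graph} (e c : ℕ)
         (ℓ : Levelling G (levels (2 ℕ.+ e) c)) (conn : Graph.Connected G) where
  open Graph G using (order)

  d T : ℕ
  d = 2 ℕ.+ e
  T = totalDistance G conn

  N D C : ℚ
  N = fromℕℚ (d ℕ.+ c)
  D = fromℕℚ d
  C = fromℕℚ c

  order-levels : order ≡ d ℕ.+ c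
  order-levels = trans (Levelling.order-length ℓ) (length-levels d c)

  distance-levels : 3 ℕ.* T ℕ.+ 3 ℕ.* (d ℕ.+ c) ≡
                    d ℕ.* d ℕ.* d ℕ.+ 2 ℕ.* d ℕ.+ 3 ℕ.* c ℕ.* (d ℕ.* d ℕ.+ d ℕ.+ c)
  distance-levels = begin
    3 ℕ.* T ℕ.+ 3 ℕ.* (d ℕ.+ c)       ≡⟨ ℕ.*-distribˡ-+ 3 T (d ℕ.+ c) ⟨
    3 ℕ.* (T ℕ.+ (d ℕ.+ c))           ≡⟨ cong (λ m → 3 ℕ.* (T ℕ.+ m)) order-levels ⟨
    3 ℕ.* (T ℕ.+ order)               ≡⟨ cong (3 ℕ.*_) (totalDistance-pairSum ℓ (levels-interval d c) conn) ⟩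
    3 ℕ.* pairSum (levels d c)        ≡⟨ pairSum-levels d c ⟩
    _ ∎
    where open ≡-Reasoning

  -- For `d = 2 + e` the polynomial exceeds the diagonal `3 (d + c)` by 1 plus an explicit natural
  -- number.
  T≢0 : T ≢ 0
  T≢0 T≡0 = ℕ.m≢1+m+n (3 ℕ.* (d ℕ.+ c)) (begin
    3 ℕ.* (d ℕ.+ c)               ≡⟨ cong (λ t → 3 ℕ.* t ℕ.+ 3 ℕ.* (d ℕ.+ c)) T≡0 ⟨
    3 ℕ.* T ℕ.+ 3 ℕ.* (d ℕ.+ c)   ≡⟨ distance-levels ⟩
    d ℕ.* d ℕ.* d ℕ.+ 2 ℕ.* d ℕ.+ 3 ℕ.* c ℕ.* (d ℕ.* d ℕ.+ d ℕ.+ c)  ≡⟨ expand e c ⟩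
    suc (3 ℕ.* (d ℕ.+ c) ℕ.+ _) ∎)
    where
    open ≡-Reasoning
    expand : ∀ e c → let d = 2 ℕ.+ e in
      d ℕ.* d ℕ.* d ℕ.+ 2 ℕ.* d ℕ.+ 3 ℕ.* c ℕ.* (d ℕ.* d ℕ.+ d ℕ.+ c) ≡
      suc (3 ℕ.* (d ℕ.+ c) ℕ.+ (5 ℕ.+ 11 ℕ.* e ℕ.+ 6 ℕ.* e ℕ.* e ℕ.+ e ℕ.* e ℕ.* e ℕ.+
        3 ℕ.* c ℕ.* (d ℕ.* d ℕ.+ 1 ℕ.+ e ℕ.+ c)))
    expand = ℕ.solve-∀

  -- The count over `ℕ` keeps the diagonal added on the left; it is subtracted only after the cast
  -- to `ℚ`.
  3T≡Q : 3 * fromℕℚ T ≡ Q N D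
  3T≡Q = begin
    3 * fromℕℚ T                                                ≡⟨ add-subtract (fromℕℚ T) D C ⟩
    3 * fromℕℚ T + 3 * (D + C) - 3 * (D + C)                    ≡⟨ cong (_- 3 * (D + C)) cast ⟩
    (D * D * D + 2 * D + 3 * C * (D * D + D + C)) - 3 * (D + C) ≡⟨ factor D C ⟩
    Q (D + C) D                                                 ≡⟨ cong (λ N → Q N D) (fromℕℚ-+ d c) ⟨
    Q N D ∎
    where
    open ≡-Reasoning
    add-subtract : ∀ T D C → 3 * T ≡ 3 * T + 3 * (D + C) - 3 * (D + C)
    add-subtract = solve-∀ ring
    factor : ∀ D C → (D * D * D + 2 * D + 3 * C * (D * D + D + C)) - 3 * (D + C) ≡
                     3 * (D + C - D) * (D * D - 1 + (D + C)) + D * (D * D - 1)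
    factor = solve-∀ ring
    -- These operators push `fromℕℚ` through a polynomial by mirroring its syntax.
    infixl 6 _⊞_
    infixl 7 _⊠_
    _⊞_ : ∀ {m n p q} → fromℕℚ m ≡ p → fromℕℚ n ≡ q → fromℕℚ (m ℕ.+ n) ≡ p + q
    _⊞_ {m} {n} refl refl = fromℕℚ-+ m n
    _⊠_ : ∀ {m n p q} → fromℕℚ m ≡ p → fromℕℚ n ≡ q → fromℕℚ (m ℕ.* n) ≡ p * q
    _⊠_ {m} {n} refl refl = fromℕℚ-* m n
    ♯ : ∀ n → fromℕℚ n ≡ fromℕℚ n
    ♯ n = refl
    cast : 3 * fromℕℚ T + 3 * (D + C) ≡ D * D * D + 2 * D + 3 * C * (D * D + D + C)
    cast = trans (sym (♯ 3 ⊠ ♯ T ⊞ ♯ 3 ⊠ (♯ d ⊞ ♯ c))) (trans (cong fromℕℚ distance-levels)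
      (♯ d ⊠ ♯ d ⊠ ♯ d ⊞ ♯ 2 ⊠ ♯ d ⊞ ♯ 3 ⊠ ♯ c ⊠ (♯ d ⊠ ♯ d ⊞ ♯ d ⊞ ♯ c)))

  Q≢0 : Q N D ≢ 0ℚ
  Q≢0 = subst (_≢ 0ℚ) 3T≡Q (*-nonzero {3} (λ ()) (T≢0 ∘ fromℕℚ-injective))

  N-1≢0 : N - 1 ≢ 0ℚ
  N-1≢0 e = contradiction (fromℕℚ-injective {d ℕ.+ c} {1} (trans (shift N) (cong (_+ 1) e))) λ ()
    where
    shift : ∀ x → x ≡ (x - 1) + 1
    shift = solve-∀ ring

  φ-total : φ G conn * fromℕℚ T ≡ N - 1
  φ-total = begin
    φ G conn * fromℕℚ T
      ≡⟨ cong (λ b → (if b then 1 else (fromℕℚ order - 1) ÷₀ fromℕℚ T) * fromℕℚ T)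
              (dec-false (order ℕ.≟ 1) order≢1) ⟩
    (fromℕℚ order - 1) ÷₀ fromℕℚ T * fromℕℚ T
      ≡⟨ ÷₀-cancel (fromℕℚ order - 1) (T≢0 ∘ fromℕℚ-injective) ⟩
    fromℕℚ order - 1
      ≡⟨ cong (λ m → fromℕℚ m - 1) order-levels ⟩
    N - 1 ∎
    where
    open ≡-Reasoning
    order≢1 : order ≢ 1
    order≢1 o = contradiction (trans (sym order-levels) o) λ ()

-- X / Y is (A′ Q − A Q′) / (A′ Q), reduced by the common factor M, where
-- A = N − 1, A′ = N′ − 1, and Q and Q′ are three times the total distances of
-- lollipops of order N and N′ on paths of D and D′ vertices.
record Reduced (N D N′ D′ X Y : ℚ) : Set where
  field
    M           : ℚ
    denominator : Y * M ≡ (N′ - 1) * (3 * (N - D) * (D * D - 1 + N) + D * (D * D - 1))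
    numerator   : X * M ≡ (N′ - 1) * (3 * (N - D) * (D * D - 1 + N) + D * (D * D - 1))
                          - (N - 1) * (3 * (N′ - D′) * (D′ * D′ - 1 + N′) + D′ * (D′ * D′ - 1))

-- Cross-multiplication by `Y * M`. This equals `(N′ - 1) * Q N D`, which is nonzero, so both
-- factors may be cancelled. The equations for `N′` and `D′` let each case express them through `n`
-- and `d`.
IMC-levels : ∀ {G conn v} e c e′ c′ →
  Levelling G (levels (2 ℕ.+ e) c) → Levelling (contract G v) (levels (2 ℕ.+ e′) c′) →
  ∀ {N D N′ D′} → fromℕℚ (2 ℕ.+ e ℕ.+ c) ≡ N → fromℕℚ (2 ℕ.+ e) ≡ D →
                  fromℕℚ (2 ℕ.+ e′ ℕ.+ c′) ≡ N′ → fromℕℚ (2 ℕ.+ e′) ≡ D′ →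
  ∀ {X Y} → Reduced N D N′ D′ X Y → IMC G conn v ≡ X ÷₀ Y
IMC-levels {G} {conn} {v} e c e′ c′ ℓ ℓ′ {N} {D} {N′} {D′} refl refl refl refl {X} {Y} reduced =
  ÷₀-unique (factorˡ-nonzero YM≢0) (*-cancelʳ M (factorʳ-nonzero {Y} YM≢0) (begin
    (1 - k) * Y * M                           ≡⟨ ℚ.*-assoc (1 - k) Y M ⟩
    (1 - k) * (Y * M)                         ≡⟨ cong ((1 - k) *_) denominator ⟩
    (1 - k) * ((N′ - 1) * Q N D)              ≡⟨ expand k ((N′ - 1) * Q N D) ⟩
    (N′ - 1) * Q N D - k * ((N′ - 1) * Q N D) ≡⟨ cong (λ x → (N′ - 1) * Q N D - x) ratio ⟩
    (N′ - 1) * Q N D - (N - 1) * Q N′ D′      ≡⟨ numerator ⟨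
    X * M ∎))
  where
  open ≡-Reasoning
  open Reduced reduced
  module L = LollipopLevels e c ℓ conn
  module L′ = LollipopLevels e′ c′ ℓ′ (contract-connected G v conn)
  f f′ s s′ k : ℚ
  f = φ G conn
  f′ = φ (contract G v) (contract-connected G v conn)
  s = fromℕℚ L.T
  s′ = fromℕℚ L′.T
  k = f ÷₀ f′
  YM≢0 : Y * M ≢ 0ℚ
  YM≢0 = subst (_≢ 0ℚ) (sym denominator) (*-nonzero L′.N-1≢0 L.Q≢0)
  f′≢0 : f′ ≢ 0ℚ
  f′≢0 = factorˡ-nonzero (subst (_≢ 0ℚ) (sym L′.φ-total) L′.N-1≢0)
  expand : ∀ k x → (1 - k) * x ≡ x - k * x
  expand = solve-∀ ring
  regroup : ∀ k f′ s s′ → k * (f′ * s′ * (3 * s)) ≡ k * f′ * s * (3 * s′)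
  regroup = solve-∀ ring
  -- Since `f = (N - 1) / s` and `f′ = (N′ - 1) / s′`, the quotient `k` is `(N - 1) s′` over
  -- `(N′ - 1) s`; factors 3 turn `s` and `s′` into values of `Q`.
  ratio : k * ((N′ - 1) * Q N D) ≡ (N - 1) * Q N′ D′
  ratio = begin
    k * ((N′ - 1) * Q N D)       ≡⟨ cong₂ (λ a q → k * (a * q)) L′.φ-total L.3T≡Q ⟨
    k * (f′ * s′ * (3 * s))      ≡⟨ regroup k f′ s s′ ⟩
    k * f′ * s * (3 * s′)        ≡⟨ cong (λ p → p * s * (3 * s′)) (÷₀-cancel f f′≢0) ⟩
    f * s * (3 * s′)             ≡⟨ cong₂ _*_ L.φ-total L′.3T≡Q ⟩
    (N - 1) * Q N′ D′ ∎

-- Parameters and polynomial identities of the four cases.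

fromℕℚ-∸ : ∀ k {m n} → n ≡ k ℕ.+ m → fromℕℚ m ≡ fromℕℚ n - fromℕℚ k
fromℕℚ-∸ k {m} refl = trans (shift (fromℕℚ k) (fromℕℚ m)) (cong (_- fromℕℚ k) (sym (fromℕℚ-+ k m)))
  where
  shift : ∀ x y → y ≡ x + y - x
  shift = solve-∀ ring

contract-lollipop : ∀ n d v {L} → collapse (height n d v) (levels d (n ∸ d)) ↭ L →
                    Levelling (contract (lollipop n d) v) L
contract-lollipop n d v c = relevel c
  (contract-levelling (lollipop-levelling n d) (levels-interval d (n ∸ d)) v)

first-reduced : ∀ N D → Reduced N D (N - 1) (D - 1)
  (3 * (N - D) * ((N - 1) * (2 * D - 1) - D * D) + D * (D - 1) * (3 * N - D - 4))
  ((N - 2) * (3 * (N - D) * (D * D - 1 + N) + D * (D * D - 1)))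
first-reduced N D = record
  { M           = 1
  ; denominator = solve (N List.∷ D List.∷ List.[]) ring
  ; numerator   = solve (N List.∷ D List.∷ List.[]) ring
  }

middle-reduced : ∀ N D → Reduced N D (N - 2) (D - 2)
  (6 * (N - D) * (2 * (D - 1) * (N - 1) - D * D)
    + 2 * (D - 1) * (3 * (D - 1) * (N - 1) - D * (D + 1)))
  ((N - 3) * (3 * (N - D) * (D * D - 1 + N) + D * (D * D - 1)))
middle-reduced N D = record
  { M           = 1
  ; denominator = solve (N List.∷ D List.∷ List.[]) ring
  ; numerator   = solve (N List.∷ D List.∷ List.[]) ring
  }

last-reduced : ∀ N D → Reduced N D (D - 1) (D - 1)
  (3 * (N - D) * (D * D - 1 + N) + D * (D - 1) * (D - N + 2))
  (3 * (N - D) * (D * D - 1 + N) + D * (D * D - 1))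
last-reduced N D = record
  -- The contracted graph is a path on `D - 1` vertices: `D - 2` is `N′ - 1` and also divides its
  -- tripled total distance `D (D - 1) (D - 2)`.
  { M           = D - 2
  ; denominator = solve (N List.∷ D List.∷ List.[]) ring
  ; numerator   = solve (N List.∷ D List.∷ List.[]) ring
  }

clique-reduced : ∀ N D → Reduced N D D D
  ((N - D) * (D * (2 * D - 1) + 3 * (N - 1)))
  (3 * (N - D) * (D * D - 1 + N) + D * (D * D - 1))
clique-reduced N D = record
  -- Likewise for a path on `D` vertices, with tripled total distance `D (D - 1) (D + 1)`.
  { M           = D - 1
  ; denominator = solve (N List.∷ D List.∷ List.[]) ring
  ; numerator   = solve (N List.∷ D List.∷ List.[]) ring
  }

theorem2p4p1 : ∀ (n d : ℕ) → 3 < d → 1 < n ∸ d →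
    let imc = IMC (lollipop n d) (lollipop-connected n d)
        N   = fromℕℚ n
        D   = fromℕℚ d
        Q   = 3 * (N - D) * (D * D - 1 + N) + D * (D * D - 1)
    in (∀ (i : Fin d) → index i ≡ 1 →
          imc (path i) ≡
            (3 * (N - D) * ((N - 1) * (2 * D - 1) - D * D) + D * (D - 1) * (3 * N - D - 4))
              ÷₀ ((N - 2) * Q))
     × (∀ (i : Fin d) → 2 ≤ index i → index i ≤ d ∸ 1 →
          imc (path i) ≡
            (6 * (N - D) * (2 * (D - 1) * (N - 1) - D * D)
              + 2 * (D - 1) * (3 * (D - 1) * (N - 1) - D * (D + 1)))
              ÷₀ ((N - 3) * Q))
     × (∀ (i : Fin d) → index i ≡ d →
          imc (path i) ≡
            (3 * (N - D) * (D * D - 1 + N) + D * (D - 1) * (D - N + 2)) ÷₀ Q)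
     × (∀ (j : Fin (n ∸ d)) →
          imc (clique j) ≡
            ((N - D) * (D * (2 * D - 1) + 3 * (N - 1))) ÷₀ Q)
-- As `d = 4 + e`, even the loss of two path vertices leaves `2 + e` of them, the form that
-- `IMC-levels` expects.
theorem2p4p1 n d@(suc (suc (suc (suc e)))) (s≤s (s≤s (s≤s (s≤s z≤n)))) 1<c =
  (λ { zero refl → formula (path zero) (1 ℕ.+ e) c (collapse-first (2 ℕ.+ e) c)
         (fromℕℚ-∸ 1 n≡d+c) (fromℕℚ-∸ 1 refl) (first-reduced N D) }) ,
  (λ { zero (s≤s ()) _
     -- The vertex has level `suc (toℕ i)`, and `i<` reads `toℕ i < 2 + e`, the bound in
     -- `collapse-middle`.
     ; (suc i) _ (s≤s i<) → formula (path (suc i)) e c (collapse-middle (toℕ i) c i<)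
         (fromℕℚ-∸ 2 n≡d+c) (fromℕℚ-∸ 2 refl) (middle-reduced N D) }) ,
  -- Index `d` is level `3 + e`, levels being counted from 0. The clique is absorbed, hence the
  -- clique size 0.
  (λ i i≡d → formula (path i) (1 ℕ.+ e) 0
         (subst (λ t → collapse t (levels d c) ↭ levels (3 ℕ.+ e) 0)
                (sym (ℕ.suc-injective i≡d)) (collapse-last (2 ℕ.+ e) c))
         (fromℕℚ-∸ 1 (cong (4 ℕ.+_) (sym (ℕ.+-identityʳ e)))) (fromℕℚ-∸ 1 refl)
         (last-reduced N D)) ,
  (λ j → formula (clique j) (2 ℕ.+ e) 0 (collapse-clique (3 ℕ.+ e) c)
         (cong (λ m → fromℕℚ (4 ℕ.+ m)) (ℕ.+-identityʳ e)) refl (clique-reduced N D))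
  where
  c : ℕ
  c = n ∸ d

  -- A nonzero `n ∸ d` shows that the subtraction was not truncated.
  n≡d+c : n ≡ d ℕ.+ c
  n≡d+c = sym (ℕ.m+[n∸m]≡n {d} {n} (ℕ.<⇒≤ (ℕ.m∸n≢0⇒n<m {n} {d} λ c≡0 → ℕ.n≮0 (subst (1 <_) c≡0 1<c))))

  N D : ℚ
  N = fromℕℚ n
  D = fromℕℚ d

  formula : ∀ v e′ c′ {N′ D′} → collapse (height n d v) (levels d c) ↭ levels (2 ℕ.+ e′) c′ →
    fromℕℚ (2 ℕ.+ e′ ℕ.+ c′) ≡ N′ → fromℕℚ (2 ℕ.+ e′) ≡ D′ → ∀ {X Y} → Reduced N D N′ D′ X Y →
    IMC (lollipop n d) (lollipop-connected n d) v ≡ X ÷₀ Y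
  formula v e′ c′ collapsed N′≡ D′≡ {X} {Y} reduced =
    IMC-levels {lollipop n d} {lollipop-connected n d} {v} (2 ℕ.+ e) c e′ c′
      (lollipop-levelling n d) (contract-lollipop n d v collapsed)
      (cong fromℕℚ (sym n≡d+c)) refl N′≡ D′≡ {X} {Y} reduced
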